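{- For each $n\in\mathbb{N}$, let $A_n$ be the number of strong-Schreier sets $S$ with $\max S=n$; let $B_n$ be the number of maximal sets $S$ with $\max S=n$; let $C_n$ be the number of weak-Schreier subsets of $\{1,2,\ldots,n\}$ (including the empty set); and let $D_n$ be the number of strong-Schreier subsets of $\{1,2,\ldots,n\}$ (including the empty set). Then for each $n\in\mathbb{N}$, $A_n=F_{n-1}$, $B_n=F_{n-2}$, $C_n=F_{n+2}$ and $D_n=F_{n+1}$.
   Context: $\mathbb{N}=\{1,2,3,\ldots\}$. All sets considered are finite subsets of $\mathbb{N}$. A nonempty finite set $S\subseteq\mathbb{N}$ is weak-Schreier if $\min S\ge |S|$, strong-Schreier if $\min S>|S|$, and maximal if $\min S=|S|$, where $|S|$ is the cardinality of $S$. The empty set is counted as weak-Schreier and strong-Schreier. The Fibonacci sequence $(F_n)_{n\ge -1}$ is defined by $F_{ -1}=1$, $F_0=0$, and $F_m=F_{m-1}+F_{m-2}$ for all $m\ge 1$. -}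

module Defs where

open import Data.Empty using (⊥-elim)
open import Data.Integer.Base using (ℤ; +_; -[1+_])
open import Data.List.Base using (List; []; _∷_; length)
open import Data.List.Membership.Propositional using () renaming (_∈_ to _∈ᴸ_)
open import Data.List.Relation.Unary.All as All using (All; []; _∷_)
open import Data.List.Relation.Unary.AllPairs as AllPairs using (AllPairs; []; _∷_)
open import Data.List.Relation.Unary.Any using (here; there)
open import Data.List.Relation.Unary.Unique.Propositional using (Unique)
open import Data.Nat.Base using (ℕ; zero; suc; _+_; _≤_; _<_; _≥_; _>_)
open import Data.Nat.Properties using (≤-refl; ≤-antisym; ≤-irrelevant; <⇒≤; <-irrefl; <-irrelevant)
open import Data.Product.Base using (∃-syntax; _×_; _,_)
open import Data.Sum.Base using (_⊎_)
open import Function.Bundles using (_⇔_; mk⇔; Equivalence)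
open import Relation.Binary.PropositionalEquality using (_≡_; refl; cong)

-- A finite set of positive integers is represented by the strictly increasing
-- list of its elements.  By `ext` below, _≡_ on FinSet is equality of sets.
record FinSet : Set where
  constructor mkFinSet
  field
    elements   : List ℕ
    increasing : AllPairs _<_ elements
    positive   : All (1 ≤_) elements

open FinSet public

infix 4 _∈_ _⊆[1‥_]

_∈_ : ℕ → FinSet → Set
x ∈ S = x ∈ᴸ elements S

∅ : FinSet
∅ = mkFinSet [] [] []

∣_∣ : FinSet → ℕ
∣ S ∣ = length (elements S)

private
  head≤ : ∀ {a b as} → All (a <_) as → b ∈ᴸ a ∷ as → a ≤ b
  head≤ a< (here refl) = ≤-refl
  head≤ a< (there p)   = <⇒≤ (All.lookup a< p)

  tail : ∀ {a z as bs} → All (a <_) as → z ∈ᴸ as → z ∈ᴸ a ∷ bs → z ∈ᴸ bs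
  tail a< p (here refl) = ⊥-elim (<-irrefl refl (All.lookup a< p))
  tail a< p (there q)   = q

  ext-list : ∀ {xs ys} → AllPairs _<_ xs → AllPairs _<_ ys →
             (∀ z → z ∈ᴸ xs ⇔ z ∈ᴸ ys) → xs ≡ ys
  ext-list [] [] _ = refl
  ext-list [] (_∷_ {y} _ _) eq with () ← Equivalence.from (eq y) (here refl)
  ext-list (_∷_ {x} _ _) [] eq with () ← Equivalence.to (eq x) (here refl)
  ext-list {x ∷ xs} {y ∷ ys} (x< ∷ xs↑) (y< ∷ ys↑) eq
    with refl ← ≤-antisym (head≤ x< (Equivalence.from (eq y) (here refl)))
                          (head≤ y< (Equivalence.to   (eq x) (here refl)))
    = cong (x ∷_) (ext-list xs↑ ys↑ λ z →
        mk⇔ (λ p → tail x< p (Equivalence.to   (eq z) (there p)))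
            (λ p → tail y< p (Equivalence.from (eq z) (there p))))

ext : ∀ {S T} → (∀ x → x ∈ S ⇔ x ∈ T) → S ≡ T
ext {mkFinSet xs i p} {mkFinSet ys j q} eq
  with refl ← ext-list i j eq
  with refl ← AllPairs.irrelevant <-irrelevant i j
  with refl ← All.irrelevant ≤-irrelevant p q
  = refl

IsMin IsMax : FinSet → ℕ → Set
IsMin S m = m ∈ S × (∀ x → x ∈ S → m ≤ x)
IsMax S m = m ∈ S × (∀ x → x ∈ S → x ≤ m)

_⊆[1‥_] : FinSet → ℕ → Set
S ⊆[1‥ n ] = ∀ x → x ∈ S → 1 ≤ x × x ≤ n

WeakSchreier StrongSchreier Maximal : FinSet → Set
WeakSchreier   S = S ≡ ∅ ⊎ (∃[ m ] IsMin S m × m ≥ ∣ S ∣)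
StrongSchreier S = S ≡ ∅ ⊎ (∃[ m ] IsMin S m × m > ∣ S ∣)
Maximal        S = ∃[ m ] IsMin S m × m ≡ ∣ S ∣

-- There are exactly k sets S with P S: some duplicate-free list of length k
-- contains precisely these sets.
NumberOf : (FinSet → Set) → ℕ → Set
NumberOf P k = ∃[ Ss ] Unique Ss × (∀ S → S ∈ᴸ Ss ⇔ P S) × length Ss ≡ k

-- Indexed from -1; the value at indices below -1 is junk.
F : ℤ → ℕ
F -[1+ suc _ ]    = 0
F -[1+ zero ]     = 1
F (+ 0)           = 0
F (+ 1)           = F (+ 0) + F -[1+ 0 ]
F (+ suc (suc m)) = F (+ suc m) + F (+ m)

{-# OPTIONS --safe #-}

-- Deleting the maximum n from S turns |S| ≤ min S into the strong condition,
-- and lowering every element by 1 turns the strong condition back into the weak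
-- one.  Splitting by whether n ∈ S, the weak-Schreier subsets of [1‥n] therefore
-- satisfy the Fibonacci recurrence.  For n ≥ 2 the same two maps turn |S| = min S
-- into |S| + 1 = min S and back, so the maximal subsets of [1‥n] satisfy it too.
module Submission where

open import Data.Empty using (⊥-elim)
open import Data.Integer.Base using (+_; _-_) renaming (_+_ to _+ℤ_)
open import Data.List.Base using (List; []; _∷_; _++_; _∷ʳ_; map; length; initLast; _∷ʳ′_)
open import Data.List.Membership.DecPropositional using (_∈?_)
open import Data.List.Membership.Propositional using () renaming (_∈_ to _∈ᴸ_)
open import Data.List.Membership.Propositional.Properties using (∈-++⁺ˡ; ∈-++⁺ʳ; ∈-++⁻; ∈-map⁺; ∈-map⁻)
open import Data.List.Properties using (++-identityʳ; length-map; length-++; length-++-sucʳ; map-injective; ∷ʳ-injectiveˡ)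
open import Data.List.Relation.Unary.All as All using (All; []; _∷_)
import Data.List.Relation.Unary.All.Properties as All
open import Data.List.Relation.Unary.AllPairs as AllPairs using (AllPairs; []; _∷_)
import Data.List.Relation.Unary.AllPairs.Properties as AllPairs
open import Data.List.Relation.Unary.Any using (here; there)
open import Data.List.Relation.Unary.Unique.Propositional using (Unique)
import Data.List.Relation.Unary.Unique.Propositional.Properties as Unique
open import Data.Nat.Base using (ℕ; zero; suc; _+_; _≤_; _<_; z≤n; s≤s; s≤s⁻¹)
open import Data.Nat.Properties
open import Data.Product.Base using (∃-syntax; _×_; _,_; proj₁; proj₂; map₂)
open import Data.Sum.Base as Sum using (_⊎_; inj₁; inj₂)
open import Function.Base using (_∘_)
open import Function.Bundles using (_⇔_; mk⇔; Equivalence)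
open import Level using (0ℓ)
open import Relation.Binary.PropositionalEquality using (_≡_; refl; sym; trans; cong; cong₂; subst)
open import Relation.Nullary using (¬_; yes; no)
open import Relation.Unary using (Pred; _∩_; _∪_; _⊆_; _≐_)
open import Defs

open Equivalence using (to; from)

private variable
  A B : Set
  P Q : Pred A 0ℓ
  a b k n x : ℕ
  xs ys : List ℕ

-- Counting the elements that satisfy a predicate.

-- `NumberOf` over an arbitrary type, so that counting can be done on bare lists, free of the proof
-- fields of `FinSet`.
Count : Pred A 0ℓ → ℕ → Set
Count {A} P k = ∃[ xs ] Unique xs × (∀ (x : A) → x ∈ᴸ xs ⇔ P x) × length xs ≡ k

Count-resp-≐ : P ≐ Q → Count P k → Count Q k
Count-resp-≐ (P⊆Q , Q⊆P) (xs , u , mem , l) =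
  xs , u , (λ x → mk⇔ (P⊆Q ∘ to (mem x)) (from (mem x) ∘ Q⊆P)) , l

Count-∅ : (∀ x → ¬ P x) → Count P 0
Count-∅ ¬P = [] , [] , (λ x → mk⇔ (λ ()) (⊥-elim ∘ ¬P x)) , refl

Count-singleton : ∀ {x : A} → P x → (∀ y → P y → y ≡ x) → Count P 1
Count-singleton {x = x} Px unique =
  x ∷ [] , [] ∷ [] , (λ y → mk⇔ (λ { (here refl) → Px }) (here ∘ unique y)) , refl

Count-∪ : (∀ {x} → P x → ¬ Q x) → Count P a → Count Q b → Count (P ∪ Q) (a + b)
Count-∪ disjoint (xs , u , mem , l) (ys , v , mem′ , l′) =
  xs ++ ys ,
  Unique.++⁺ u v (λ (p , q) → disjoint (to (mem _) p) (to (mem′ _) q)) ,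
  (λ x → mk⇔ (Sum.map (to (mem x)) (to (mem′ x)) ∘ ∈-++⁻ xs)
             (λ { (inj₁ p) → ∈-++⁺ˡ (from (mem x) p)
                ; (inj₂ q) → ∈-++⁺ʳ xs (from (mem′ x) q) })) ,
  trans (length-++ xs) (cong₂ _+_ l l′)

Count-map : (f : A → B) → (∀ {x y} → f x ≡ f y → x ≡ y) →
            Count P k → Count (λ y → ∃[ x ] P x × y ≡ f x) k
Count-map f inj (xs , u , mem , l) =
  map f xs , Unique.map⁺ inj u ,
  (λ y → mk⇔ (map₂ (λ (p , eq) → to (mem _) p , eq) ∘ ∈-map⁻ f)
             (λ { (x , Px , refl) → ∈-map⁺ f (from (mem x) Px) })) ,
  trans (length-map f xs) l

-- Bounded increasing lists as finite sets.

Increasing≤ : ℕ → Pred (List ℕ) 0ℓ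
Increasing≤ n xs = AllPairs _<_ xs × All (λ x → 1 ≤ x × x ≤ n) xs

elements-injective : ∀ {S T} → elements S ≡ elements T → S ≡ T
elements-injective {S} {T} eq =
  ext λ x → mk⇔ (subst (x ∈ᴸ_) eq) (subst (x ∈ᴸ_) (sym eq))

-- In the form `map elements Ss`, uniqueness and length of an enumeration pull back from lists to
-- `FinSet`.
preimages : ∀ {xss} → All (Increasing≤ n) xss → ∃[ Ss ] xss ≡ map elements Ss
preimages [] = [] , refl
preimages {xss = xs ∷ _} ((inc , bnd) ∷ ps) with Ss , eq ← preimages ps =
  mkFinSet xs inc (All.map proj₁ bnd) ∷ Ss , cong (xs ∷_) eq

∈-map-elements⁻ : ∀ {S Ss} → elements S ∈ᴸ map elements Ss → S ∈ᴸ Ss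
∈-map-elements⁻ {S} {Ss} p with T , T∈ , eq ← ∈-map⁻ elements p =
  subst (_∈ᴸ Ss) (sym (elements-injective {S} {T} eq)) T∈

numberOf : {R : FinSet → Set} → (∀ S → (Increasing≤ n ∩ P) (elements S) ⇔ R S) →
           Count (Increasing≤ n ∩ P) k → NumberOf R k
numberOf {n = n} {P = P} {R = R} P⇔R (xss , u , mem , l)
  with Ss , refl ← preimages (All.tabulate (proj₁ ∘ to (mem _)))
  = Ss , Unique.map⁻ u ,
    (λ S → mk⇔ (to (P⇔R S) ∘ to (mem _) ∘ ∈-map⁺ elements)
               (∈-map-elements⁻ ∘ from (mem _) ∘ from (P⇔R S))) ,
    trans (sym (length-map elements Ss)) l

-- Splitting off the maximum.

AllPairs-∷ʳ⁻ : ∀ {R : ℕ → ℕ → Set} xs → AllPairs R (xs ∷ʳ x) →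
               AllPairs R xs × All (λ y → R y x) xs
AllPairs-∷ʳ⁻ []       _        = [] , []
AllPairs-∷ʳ⁻ (y ∷ xs) (r ∷ rs) with rs′ , all ← AllPairs-∷ʳ⁻ xs rs | r′ , Ryx ← All.∷ʳ⁻ r =
  r′ ∷ rs′ , Ryx ∷ all

Increasing≤0⇒[] : Increasing≤ 0 xs → xs ≡ []
Increasing≤0⇒[] {[]}    _                    = refl
Increasing≤0⇒[] {_ ∷ _} (_ , (1≤x , x≤0) ∷ _) = ⊥-elim (<⇒≱ 1≤x x≤0)

Increasing≤-suc : Increasing≤ n ⊆ Increasing≤ (suc n)
Increasing≤-suc (inc , bnd) = inc , All.map (map₂ m≤n⇒m≤1+n) bnd

suc-n∉ : Increasing≤ n xs → ¬ suc n ∈ᴸ xs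
suc-n∉ (_ , bnd) p = <-irrefl refl (proj₂ (All.lookup bnd p))

Increasing≤-pred : Increasing≤ (suc n) xs → ¬ suc n ∈ᴸ xs → Increasing≤ n xs
Increasing≤-pred (inc , bnd) ∉xs = inc , All.tabulate λ p →
  let 1≤x , x≤ = All.lookup bnd p
  in 1≤x , s≤s⁻¹ (≤∧≢⇒< x≤ λ { refl → ∉xs p })

Increasing≤-∷ʳ⁺ : Increasing≤ n xs → Increasing≤ (suc n) (xs ∷ʳ suc n)
Increasing≤-∷ʳ⁺ (inc , bnd) =
  AllPairs.++⁺ inc ([] ∷ []) (All.map (λ (_ , x≤n) → s≤s x≤n ∷ []) bnd) ,
  All.∷ʳ⁺ (All.map (map₂ m≤n⇒m≤1+n) bnd) (s≤s z≤n , ≤-refl)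

Increasing≤-∷ʳ⁻ : Increasing≤ (suc n) xs → suc n ∈ᴸ xs →
                  ∃[ ys ] Increasing≤ n ys × xs ≡ ys ∷ʳ suc n
Increasing≤-∷ʳ⁻ {n} {xs} (inc , bnd) p with initLast xs
... | ys ∷ʳ′ x
  with inc′ , ys<x ← AllPairs-∷ʳ⁻ ys inc
  with bnd′ , _ , x≤ ← All.∷ʳ⁻ bnd
  -- `suc n` is an entry, hence at most the last entry `x`; the bound gives the converse.
  with refl ← ≤-antisym x≤ (All.lookup (All.∷ʳ⁺ (All.map <⇒≤ ys<x) ≤-refl) p)
  = ys , (inc′ , All.tabulate (λ q → proj₁ (All.lookup bnd′ q) , s≤s⁻¹ (All.lookup ys<x q))) , refl

Count-∷ʳ : Count (λ ys → Increasing≤ n ys × P (ys ∷ʳ suc n)) k →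
           Count (Increasing≤ (suc n) ∩ (suc n ∈ᴸ_) ∩ P) k
Count-∷ʳ {P = P} c = Count-resp-≐
  ( (λ { (ys , (i , Pys) , refl) → Increasing≤-∷ʳ⁺ i , ∈-++⁺ʳ ys (here refl) , Pys })
  , (λ (i , p , Pxs) → let ys , j , eq = Increasing≤-∷ʳ⁻ i p
                       in ys , (j , subst P eq Pxs) , eq) )
  (Count-map (_∷ʳ _) (∷ʳ-injectiveˡ _ _) c)

-- Splits by whether `suc n` is an entry; the second count refers to what is left after deleting it.
Count-suc : Count (Increasing≤ n ∩ P) a → Count (λ ys → Increasing≤ n ys × P (ys ∷ʳ suc n)) b →
            Count (Increasing≤ (suc n) ∩ P) (a + b)
Count-suc {n} {P} ca cb = Count-resp-≐
  ( (λ { (inj₁ (i , Pxs))     → Increasing≤-suc i , Pxs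
       ; (inj₂ (i , _ , Pxs)) → i , Pxs })
  , split )
  (Count-∪ (λ (i , _) (_ , p , _) → suc-n∉ i p) ca (Count-∷ʳ {P = P} cb))
  where
  split : ∀ {xs} → (Increasing≤ (suc n) ∩ P) xs →
          ((Increasing≤ n ∩ P) ∪ (Increasing≤ (suc n) ∩ (suc n ∈ᴸ_) ∩ P)) xs
  split {xs} (i , Pxs) with _∈?_ _≟_ (suc n) xs
  ... | yes p = inj₂ (i , p , Pxs)
  ... | no ¬p = inj₁ (Increasing≤-pred i ¬p , Pxs)

-- Lowering every element by 1.

Increasing≤-map-suc⁺ : Increasing≤ n xs → Increasing≤ (suc n) (map suc xs)
Increasing≤-map-suc⁺ (inc , bnd) =
  AllPairs.map⁺ (AllPairs.map s≤s inc) , All.map⁺ (All.map (λ (_ , x≤n) → s≤s z≤n , s≤s x≤n) bnd)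

Increasing≤-map-suc⁻ : Increasing≤ (suc n) xs → All (1 <_) xs →
                       ∃[ ys ] Increasing≤ n ys × xs ≡ map suc ys
Increasing≤-map-suc⁻ {xs = []} _ _ = [] , ([] , []) , refl
Increasing≤-map-suc⁻ {xs = suc x ∷ xs} (x< ∷ inc , (_ , s≤s x≤n) ∷ bnd) (s≤s 1≤x ∷ 1<)
  with ys , (inc′ , bnd′) , refl ← Increasing≤-map-suc⁻ (inc , bnd) 1<
  = x ∷ ys , (All.map s≤s⁻¹ (All.map⁻ x<) ∷ inc′ , (1≤x , x≤n) ∷ bnd′) , refl

Count-map-suc : (∀ {ys} → P ys ⇔ Q (map suc ys)) → Q ⊆ All (1 <_) →
                Count (Increasing≤ n ∩ P) k → Count (Increasing≤ (suc n) ∩ Q) k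
Count-map-suc {Q = Q} P⇔Q Q⇒1< c = Count-resp-≐
  ( (λ { (ys , (i , Pys) , refl) → Increasing≤-map-suc⁺ i , to P⇔Q Pys })
  , (λ (i , Qxs) → let ys , j , eq = Increasing≤-map-suc⁻ i (Q⇒1< Qxs)
                   in ys , (j , from P⇔Q (subst Q eq Qxs)) , eq) )
  (Count-map (map suc) (map-injective suc-injective) c)

-- The Fibonacci recurrence.

-- Deleting the maximum turns `P` into `Q`, and lowering turns `Q` back into `P`; `k` is the offset
-- of the index. `last` speaks of a deleted maximum of at least 2, because for maximal sets the
-- equivalence fails at {1}: deleting 1 leaves ∅, which is not `PreMax`.
Count-fibonacci :
  (∀ {n ys} → Increasing≤ (suc n) ys → P (ys ∷ʳ suc (suc n)) ⇔ Q ys) →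
  (∀ {ys} → P ys ⇔ Q (map suc ys)) → Q ⊆ All (1 <_) →
  ∀ k → Count (Increasing≤ 0 ∩ P) (F (+ k)) → Count (Increasing≤ 1 ∩ P) (F (+ suc k)) →
  ∀ n → Count (Increasing≤ n ∩ P) (F (+ (n + k)))
Count-fibonacci {P = P} {Q = Q} last shift 1< k c₀ c₁ = go
  where
  go : ∀ n → Count (Increasing≤ n ∩ P) (F (+ (n + k)))
  go 0             = c₀
  go 1             = c₁
  -- The sum of the two counts is definitionally `F` at `suc (suc n) + k`.
  go (suc (suc n)) = Count-suc (go (suc n)) (Count-resp-≐
    ((λ (i , q) → i , from (last i) q) , (λ (i , p) → i , to (last i) p))
    (Count-map-suc {Q = Q} shift 1< (go n)))

-- The Schreier conditions on lists.

-- Bounding every entry replaces speaking of the minimum and covers the empty list. `PreMax`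
-- expresses that the minimum is one more than the length.
Weak Strong Max PreMax : Pred (List ℕ) 0ℓ
Weak   xs = All (length xs ≤_) xs
Strong xs = All (length xs <_) xs
Max    xs = length xs ∈ᴸ xs × Weak xs
PreMax xs = suc (length xs) ∈ᴸ xs × Strong xs

length-∷ʳ : ∀ (xs : List ℕ) x → length (xs ∷ʳ x) ≡ suc (length xs)
length-∷ʳ xs x = trans (length-++-sucʳ xs x []) (cong (suc ∘ length) (++-identityʳ xs))

Strong⇒length≤ : Increasing≤ n xs → Strong xs → length xs ≤ n
Strong⇒length≤ {xs = []}    _                     _          = z≤n
Strong⇒length≤ {xs = _ ∷ _} (_ , (_ , x≤n) ∷ _) (len<x ∷ _) = <⇒≤ (<-≤-trans len<x x≤n)

Strong⇒1< : Strong ⊆ All (1 <_)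
Strong⇒1< {[]}    _ = []
Strong⇒1< {_ ∷ _} s = All.map (≤-trans (s≤s (s≤s z≤n))) s

-- The length grows by one, so `≤` for the longer list is `<` on the entries of `ys`. The new entry
-- meets its own bound because a strong list in [1‥n] has length at most n.
Weak-∷ʳ : Increasing≤ n ys → Weak (ys ∷ʳ suc n) ⇔ Strong ys
Weak-∷ʳ {n} {ys} i rewrite length-∷ʳ ys (suc n) =
  mk⇔ (proj₁ ∘ All.∷ʳ⁻) (λ s → All.∷ʳ⁺ s (s≤s (Strong⇒length≤ i s)))

-- The shift raises every entry by one and keeps the length.
Weak⇔Strong-map-suc : Weak ys ⇔ Strong (map suc ys)
Weak⇔Strong-map-suc {ys} rewrite length-map suc ys =
  mk⇔ (All.map⁺ ∘ All.map s≤s) (All.map s≤s⁻¹ ∘ All.map⁻)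

∈-map-suc : x ∈ᴸ ys ⇔ suc x ∈ᴸ map suc ys
∈-map-suc = mk⇔ (∈-map⁺ suc) λ p → let _ , q , eq = ∈-map⁻ suc p
                                   in subst (_∈ᴸ _) (sym (suc-injective eq)) q

-- The extended list has length `suc (length ys)`. That number has to be an entry of `ys` itself,
-- since it cannot equal the appended maximum.
Max-∷ʳ : Increasing≤ (suc n) ys → Max (ys ∷ʳ suc (suc n)) ⇔ PreMax ys
Max-∷ʳ {n} {ys} i = mk⇔
  (λ (p , w) → let s = to (Weak-∷ʳ i) w
               in drop-last s (∈-++⁻ ys (subst (_∈ᴸ ys ∷ʳ suc (suc n)) (length-∷ʳ ys _) p)) , s)
  (λ (p , s) → subst (_∈ᴸ ys ∷ʳ suc (suc n)) (sym (length-∷ʳ ys _)) (∈-++⁺ˡ p) , from (Weak-∷ʳ i) s)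
  where
  -- |ys| = n + 1 forces ys ≠ ∅, whence |ys| < min ys ≤ n + 1.
  drop-last : Strong ys → suc (length ys) ∈ᴸ ys ⊎ suc (length ys) ∈ᴸ suc (suc n) ∷ [] →
              suc (length ys) ∈ᴸ ys
  drop-last s (inj₁ p) = p
  drop-last s (inj₂ (here eq)) = ⊥-elim (impossible i s (suc-injective eq))
    where
    impossible : ∀ {ys} → Increasing≤ (suc n) ys → Strong ys → ¬ length ys ≡ suc n
    impossible {_ ∷ _} (_ , (_ , x≤) ∷ _) (len<x ∷ _) eq = <-irrefl eq (<-≤-trans len<x x≤)

Max⇔PreMax-map-suc : Max ys ⇔ PreMax (map suc ys)
Max⇔PreMax-map-suc {ys} = mk⇔
  (λ (p , w) → subst (λ l → suc l ∈ᴸ map suc ys) (sym (length-map suc ys)) (to ∈-map-suc p) ,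
               to Weak⇔Strong-map-suc w)
  (λ (p , s) → from ∈-map-suc (subst (λ l → suc l ∈ᴸ map suc ys) (length-map suc ys) p) ,
               from Weak⇔Strong-map-suc s)

-- Counting the subsets of [1‥n].

Count-Increasing≤0 : P [] → Count (Increasing≤ 0 ∩ P) 1
Count-Increasing≤0 P[] =
  Count-singleton (([] , []) , P[]) (λ _ (i , _) → Increasing≤0⇒[] i)

Count-Weak : ∀ n → Count (Increasing≤ n ∩ Weak) (F (+ (n + 2)))
Count-Weak = Count-fibonacci {P = Weak} {Q = Strong} Weak-∷ʳ Weak⇔Strong-map-suc Strong⇒1< 2
  -- Offset 2: F_2 = 1 counts ∅, and F_3 = 2 counts ∅ and {1}.
  (Count-Increasing≤0 [])
  (Count-suc (Count-Increasing≤0 []) (Count-Increasing≤0 (s≤s z≤n ∷ [])))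

-- By the shift, strong subsets of [1‥n+1] correspond to weak subsets of [1‥n].
Count-Strong : ∀ n → Count (Increasing≤ n ∩ Strong) (F (+ (n + 1)))
Count-Strong zero    = Count-Increasing≤0 []
Count-Strong (suc n) = subst (Count (Increasing≤ (suc n) ∩ Strong) ∘ F ∘ +_) (+-suc n 1)
  (Count-map-suc {Q = Strong} Weak⇔Strong-map-suc Strong⇒1< (Count-Weak n))

Count-Max∷ʳ1 : Count (λ ys → Increasing≤ 0 ys × Max (ys ∷ʳ 1)) 1
Count-Max∷ʳ1 = Count-Increasing≤0 (here refl , s≤s z≤n ∷ [])

Count-Max : ∀ n → Count (Increasing≤ n ∩ Max) (F (+ n))
Count-Max n = subst (Count (Increasing≤ n ∩ Max) ∘ F ∘ +_) (+-identityʳ n)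
  (Count-fibonacci {P = Max} {Q = PreMax} Max-∷ʳ Max⇔PreMax-map-suc (Strong⇒1< ∘ proj₂) 0
    -- Offset 0: F_0 = 0, as ∅ is not maximal, and F_1 = 0 + 1 counts {1}.
    none (Count-suc none Count-Max∷ʳ1) n)
  where
  none : Count (Increasing≤ 0 ∩ Max) 0
  none = Count-∅ λ { _ (i , p , _) → ∉[] (Increasing≤0⇒[] i) p }
    where
    ∉[] : xs ≡ [] → ¬ x ∈ᴸ xs
    ∉[] refl ()

-- Counting the sets with a given maximum.

Count-Weak-max : ∀ n → Count (Increasing≤ (suc n) ∩ (suc n ∈ᴸ_) ∩ Weak) (F (+ (n + 1)))
Count-Weak-max n = Count-∷ʳ {P = Weak} (Count-resp-≐
  ((λ (i , s) → i , from (Weak-∷ʳ i) s) , (λ (i , w) → i , to (Weak-∷ʳ i) w)) (Count-Strong n))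

-- Lowering a strong set with maximum n + 2 gives a weak set with maximum n + 1. Maximum 1 is
-- impossible, as strong sets have all elements above 1.
Count-Strong-max : ∀ n → Count (Increasing≤ (suc n) ∩ (suc n ∈ᴸ_) ∩ Strong) (F (+ n))
Count-Strong-max zero = Count-∅ λ _ (_ , 1∈ , s) → <-irrefl refl (All.lookup (Strong⇒1< s) 1∈)
Count-Strong-max (suc n) = subst
  (Count (Increasing≤ (suc (suc n)) ∩ (suc (suc n) ∈ᴸ_) ∩ Strong) ∘ F ∘ +_) (+-comm n 1)
  (Count-map-suc {Q = (suc (suc n) ∈ᴸ_) ∩ Strong}
    (mk⇔ (λ (p , w) → to ∈-map-suc p , to Weak⇔Strong-map-suc w)
         (λ (p , s) → from ∈-map-suc p , from Weak⇔Strong-map-suc s))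
    (Strong⇒1< ∘ proj₂) (Count-Weak-max n))

Count-Max-max : ∀ n → Count (Increasing≤ (suc n) ∩ (suc n ∈ᴸ_) ∩ Max) (F (+ suc n - + 2))
Count-Max-max zero = Count-∷ʳ {P = Max} Count-Max∷ʳ1
Count-Max-max (suc n) = Count-∷ʳ {P = Max} (Count-resp-≐
  ((λ (i , s) → i , from (Max-∷ʳ i) s) , (λ (i , w) → i , to (Max-∷ʳ i) w))
  (Count-map-suc {Q = PreMax} Max⇔PreMax-map-suc (Strong⇒1< ∘ proj₂) (Count-Max n)))

-- Translation to the conditions on `FinSet`.

-- The head of an increasing list is its minimum. Taking `k` as the size of `S` gives the weak
-- condition, and as its successor the strong one.
All≤⇔IsMin : ∀ S k → All (k ≤_) (elements S) ⇔ (S ≡ ∅ ⊎ ∃[ m ] IsMin S m × k ≤ m)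
All≤⇔IsMin S k = mk⇔ (⇒ S) λ { (inj₁ refl) → []
                              ; (inj₂ (m , (_ , m≤) , k≤m)) → All.tabulate (≤-trans k≤m ∘ m≤ _) }
  where
  ⇒ : ∀ S → All (k ≤_) (elements S) → S ≡ ∅ ⊎ ∃[ m ] IsMin S m × k ≤ m
  ⇒ (mkFinSet [] [] []) [] = inj₁ refl
  ⇒ (mkFinSet (x ∷ xs) (x< ∷ _) _) (k≤x ∷ _) =
    inj₂ (x , (here refl , λ { _ (here refl) → ≤-refl ; _ (there p) → <⇒≤ (All.lookup x< p) }) , k≤x)

-- `Weak` makes the size a lower bound, and membership makes it attained, so it is the minimum.
Max⇔Maximal : ∀ S → Max (elements S) ⇔ Maximal S
Max⇔Maximal S = mk⇔
  (λ (p , w) → ∣ S ∣ , (p , λ _ → All.lookup w) , refl)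
  (λ { (_ , (p , m≤) , refl) → p , All.tabulate (m≤ _) })

Increasing≤⇔⊆ : ∀ S → Increasing≤ n (elements S) ⇔ S ⊆[1‥ n ]
Increasing≤⇔⊆ S = mk⇔ (λ (_ , bnd) _ → All.lookup bnd) (λ sub → increasing S , All.tabulate (sub _))

numberOf-⊆ : {R : FinSet → Set} → (∀ S → P (elements S) ⇔ R S) →
             Count (Increasing≤ n ∩ P) k → NumberOf (λ S → R S × S ⊆[1‥ n ]) k
numberOf-⊆ {P = P} P⇔R = numberOf {P = P} λ S → mk⇔
  (λ (i , p) → to (P⇔R S) p , to (Increasing≤⇔⊆ S) i)
  (λ (r , s) → from (Increasing≤⇔⊆ S) s , from (P⇔R S) r)

numberOf-max : {R : FinSet → Set} → (∀ S → P (elements S) ⇔ R S) →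
               Count (Increasing≤ n ∩ (n ∈ᴸ_) ∩ P) k → NumberOf (λ S → R S × IsMax S n) k
numberOf-max {P = P} {n = n} P⇔R = numberOf {P = (n ∈ᴸ_) ∩ P} λ S → mk⇔
  (λ ((_ , bnd) , n∈ , p) → to (P⇔R S) p , n∈ , λ _ → proj₂ ∘ All.lookup bnd)
  (λ (r , n∈ , ≤n) → (increasing S , All.tabulate (λ x∈ → All.lookup (positive S) x∈ , ≤n _ x∈)) ,
                     n∈ , from (P⇔R S) r)

theorem1 : ∀ (n : ℕ) → 1 ≤ n →
    NumberOf (λ S → StrongSchreier S × IsMax S n) (F (+ n - + 1))
    × NumberOf (λ S → Maximal S × IsMax S n) (F (+ n - + 2))
    × NumberOf (λ S → WeakSchreier S × S ⊆[1‥ n ]) (F (+ n +ℤ + 2))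
    × NumberOf (λ S → StrongSchreier S × S ⊆[1‥ n ]) (F (+ n +ℤ + 1))
theorem1 (suc n) _ =
    numberOf-max {P = Strong} strong (Count-Strong-max n)
  , numberOf-max {P = Max} Max⇔Maximal (Count-Max-max n)
  , numberOf-⊆ {P = Weak} (λ S → All≤⇔IsMin S ∣ S ∣) (Count-Weak (suc n))
  , numberOf-⊆ {P = Strong} strong (Count-Strong (suc n))
  where
  strong : ∀ S → Strong (elements S) ⇔ StrongSchreier S
  strong S = All≤⇔IsMin S (suc ∣ S ∣)
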